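{- For every integer $k\ge 1$, the quantity $$\frac{k!\,(k+1)!}{n+1}\,F(n+2k;\,n,\,0),$$ as a function of the integer $n\ge 0$, is given by a polynomial in $n$ with all coefficients integers and with leading term $n^{2k-1}$.
   Context: For integers $m\ge 0$ and $n_1,n_2$, $F(m;n_1,n_2)$ denotes the number of Gessel walks with exactly $m$ steps from $(0,0)$ to $(n_1,n_2)$: lattice walks starting at the origin, each of whose $m$ steps is one of West $(-1,0)$, North-East $(1,1)$, East $(1,0)$, South-West $(-1,-1)$, and which remain in the first quadrant $\{(i,j): i\ge 0, j\ge 0\}$. In particular $F(m;n_1,n_2)=0$ if $n_1<0$ or $n_2<0$, and $F(0;n_1,n_2)=1$ if $n_1=n_2=0$ and $0$ otherwise. -}

module Defs where

open import Data.Nat as ℕ using (ℕ; zero; suc; _!)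
open import Data.Integer as ℤ using (ℤ; +_)
import Data.Integer.Properties as ℤ
open import Data.Rational as ℚ using (ℚ)
open import Data.List using (List; []; _∷_; foldr; length; filter; cartesianProductWith)
open import Data.Vec using (Vec; []; _∷_)
open import Data.Product using (_×_; _,_)
open import Data.Product.Properties using (≡-dec)
open import Relation.Binary.PropositionalEquality using (_≡_)
open import Relation.Nullary using (Dec)
open import Relation.Nullary.Decidable using (_×-dec_)

Point : Set
Point = ℤ × ℤ

data Step : Set where
  W NE E SW : Step

steps : List Step
steps = W ∷ NE ∷ E ∷ SW ∷ []

move : Point → Step → Point
move (i , j) W  = i ℤ.- + 1 , j
move (i , j) NE = i ℤ.+ + 1 , j ℤ.+ + 1
move (i , j) E  = i ℤ.+ + 1 , j
move (i , j) SW = i ℤ.- + 1 , j ℤ.- + 1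

-- A walk with m steps is its sequence of steps, the first step at the head.
Walk : ℕ → Set
Walk m = Vec Step m

endpoint : ∀ {m} → Point → Walk m → Point
endpoint p []      = p
endpoint p (s ∷ w) = endpoint (move p s) w

InQuadrant : Point → Set
InQuadrant (i , j) = (+ 0 ℤ.≤ i) × (+ 0 ℤ.≤ j)

-- Every point visited, including the start p and the endpoint, is in the
-- quadrant.
StaysInQuadrant : ∀ {m} → Point → Walk m → Set
StaysInQuadrant p []      = InQuadrant p
StaysInQuadrant p (s ∷ w) = InQuadrant p × StaysInQuadrant (move p s) w

IsGesselWalk : ∀ {m} → Point → Point → Walk m → Set
IsGesselWalk p q w = StaysInQuadrant p w × endpoint p w ≡ q

inQuadrant? : ∀ p → Dec (InQuadrant p)
inQuadrant? (i , j) = (+ 0 ℤ.≤? i) ×-dec (+ 0 ℤ.≤? j)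

staysInQuadrant? : ∀ {m} p (w : Walk m) → Dec (StaysInQuadrant p w)
staysInQuadrant? p []      = inQuadrant? p
staysInQuadrant? p (s ∷ w) = inQuadrant? p ×-dec staysInQuadrant? (move p s) w

isGesselWalk? : ∀ {m} p q (w : Walk m) → Dec (IsGesselWalk p q w)
isGesselWalk? p q w = staysInQuadrant? p w ×-dec ≡-dec ℤ._≟_ ℤ._≟_ (endpoint p w) q

-- Each of the 4 ^ m step sequences of length m occurs exactly once.
allWalks : ∀ m → List (Walk m)
allWalks zero    = [] ∷ []
allWalks (suc m) = cartesianProductWith _∷_ steps (allWalks m)

F : ℕ → ℤ → ℤ → ℕ
F m n₁ n₂ = length (filter (isGesselWalk? (+ 0 , + 0) (n₁ , n₂)) (allWalks m))

-- a₀ ∷ a₁ ∷ … ∷ a_d ∷ [] stands for a₀ + a₁ x + … + a_d x^d; trailing zeros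
-- are allowed.
Polyℤ : Set
Polyℤ = List ℤ

coeff : Polyℤ → ℕ → ℤ
coeff []      _       = + 0
coeff (a ∷ p) zero    = a
coeff (a ∷ p) (suc i) = coeff p i

eval : Polyℤ → ℤ → ℤ
eval p x = foldr (λ a r → a ℤ.+ x ℤ.* r) (+ 0) p

-- The leading term of p is x^d, with coefficient 1.
HasLeadingTerm-x^ : ℕ → Polyℤ → Set
HasLeadingTerm-x^ d p = (coeff p d ≡ + 1) × (∀ i → d ℕ.< i → coeff p i ≡ + 0)

scaledCount : ℕ → ℕ → ℚ
scaledCount k n =
  (+ (k ! ℕ.* (suc k) !) ℚ./ suc n) ℚ.* (+ F (n ℕ.+ 2 ℕ.* k) (+ n) (+ 0) ℚ./ 1)

{-# OPTIONS --safe #-}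

-- In the coordinates x and z = 2y - x a Gessel step is an independent pair of
-- ±1 steps, so unrestricted walks are counted by products of two binomial
-- coefficients, and reflecting in the line y = -1 (which exchanges the roles of
-- x and z) makes such a product vanish there.  Write a walk from the origin to
-- (n , j) as having n + 2k steps.  Starting from the walk that begins at the
-- origin, one adds for k = 1, 2, … reflected products with further virtual
-- starting points, chosen so that the count also vanishes at x = -1 for this k
-- and so that smaller k are not affected; Pascal's rule is invertible over ℤ,
-- so the weights are integers.  The result satisfies the recurrence and the
-- boundary conditions of the Gessel walks.  At j = 0 it is an integer
-- combination of products C(m,k-b) C(m,k-c) - C(m,k-1-c) C(m,k+1-b) with
-- m = n + 2k, which k! (k+1)! turns into integer polynomials in n; only
-- b = c = 0 reaches degree 2k, with leading coefficient (k + 1) - k = 1.  The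
-- factor n + 1 is the zero at x = -1.
module Submission where

open import Data.Bool using (true; false)
open import Data.Nat as ℕ using (ℕ; zero; suc; _!; _≤_; z≤n; s≤s; _∸_)
import Data.Nat.Properties as ℕ
import Data.Nat.Tactic.RingSolver as ℕ
open import Data.Integer as ℤ using (ℤ; +_; -[1+_]; _+_; _*_; _-_; -_)
import Data.Integer.Properties as ℤ
open import Data.Integer.Tactic.RingSolver using (solve-∀)
open import Data.List using ([]; _∷_; _++_; map; filter; length)
open import Data.List.Properties using (filter-++; length-++; filter-≐; filter-none)
open import Data.List.Relation.Unary.All using (universal)
open import Data.Product using (_×_; _,_; ∃; proj₁; proj₂; map₁)
open import Data.Rational as ℚ using (_/_; toℚᵘ)
import Data.Rational.Properties as ℚ
open import Data.Rational.Unnormalised as ℚᵘ using (mkℚᵘ; *≡*)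
import Data.Rational.Unnormalised.Properties as ℚᵘ
open import Data.Vec using ([]; _∷_)
open import Function using (_∘_; id)
open import Relation.Binary.PropositionalEquality
open import Relation.Nullary using (¬_; does; yes; no)
open import Relation.Unary using (Decidable)
open import Defs
open ≡-Reasoning

-- Rows of Pascal's triangle with arbitrary initial row

Row : Set
Row = ℕ → ℤ

pascalStep : Row → Row
pascalStep r zero    = r zero
pascalStep r (suc s) = r s + r (suc s)

-- Reading r as a power series, this is multiplication by (1 + x)^M: the entry at s is the sum over
-- i of `r i` times C(M, s - i). The weights `r i` belong to virtual starting points.
pascal : ℕ → Row → Row
pascal zero    r = r
pascal (suc M) r = pascalStep (pascal M r)

-- Division of a power series by 1 + x, possible over ℤ because the constant term is 1.
unpascalStep : Row → Row
unpascalStep r zero    = r zero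
unpascalStep r (suc s) = r (suc s) - unpascalStep r s

unpascal : ℕ → Row → Row
unpascal zero    r = r
unpascal (suc M) r = unpascal M (unpascalStep r)

pascal-unpascal : ∀ M r → pascal M (unpascal M r) ≗ r
pascal-unpascal zero    r s       = refl
pascal-unpascal (suc M) r zero    = pascal-unpascal M (unpascalStep r) zero
pascal-unpascal (suc M) r (suc s) = begin
  pascal M (unpascal M (unpascalStep r)) s + pascal M (unpascal M (unpascalStep r)) (suc s)
    ≡⟨ cong₂ _+_ (pascal-unpascal M (unpascalStep r) s) (pascal-unpascal M (unpascalStep r) (suc s)) ⟩
  unpascalStep r s + (r (suc s) - unpascalStep r s)
    ≡⟨ cancel (unpascalStep r s) (r (suc s)) ⟩
  r (suc s) ∎
  where
  cancel : ∀ x y → x + (y - x) ≡ y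
  cancel = solve-∀

VanishesUpTo : ℕ → Row → Set
VanishesUpTo b r = ∀ {s} → s ℕ.≤ b → r s ≡ + 0

pascal-vanishes : ∀ {b r} M → VanishesUpTo b r → VanishesUpTo b (pascal M r)
pascal-vanishes         zero    v s≤b = v s≤b
pascal-vanishes         (suc M) v {zero}  s≤b = pascal-vanishes M v s≤b
pascal-vanishes {r = r} (suc M) v {suc s} s≤b =
  cong₂ _+_ (pascal-vanishes {r = r} M v (ℕ.<⇒≤ s≤b)) (pascal-vanishes {r = r} M v s≤b)

unpascalStep-vanishes : ∀ {b r} → VanishesUpTo b r → VanishesUpTo b (unpascalStep r)
unpascalStep-vanishes         v {zero}  s≤b = v s≤b
unpascalStep-vanishes {r = r} v {suc s} s≤b =
  cong₂ _-_ (v s≤b) (unpascalStep-vanishes {r = r} v (ℕ.<⇒≤ s≤b))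

unpascal-vanishes : ∀ {b r} M → VanishesUpTo b r → VanishesUpTo b (unpascal M r)
unpascal-vanishes         zero    v = v
unpascal-vanishes {r = r} (suc M) v =
  unpascal-vanishes {r = unpascalStep r} M (unpascalStep-vanishes {r = r} v)

-- The constant term of (1 + x)^M is 1, so the first coefficient after the known zeros is kept.
pascal-leading : ∀ {b r} M → VanishesUpTo b r → pascal M r (suc b) ≡ r (suc b)
pascal-leading             zero    v = refl
pascal-leading {b} {r} (suc M) v = begin
  pascal M r b + pascal M r (suc b) ≡⟨ cong₂ _+_ (pascal-vanishes {r = r} M v ℕ.≤-refl) (pascal-leading {r = r} M v) ⟩
  + 0 + r (suc b)                   ≡⟨ ℤ.+-identityˡ _ ⟩
  r (suc b)                         ∎

unit : ℕ → Row
unit zero    zero    = + 1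
unit zero    (suc s) = + 0
unit (suc b) zero    = + 0
unit (suc b) (suc s) = unit b s

unit-diagonal : ∀ b → unit b b ≡ + 1
unit-diagonal zero    = refl
unit-diagonal (suc b) = unit-diagonal b

unit-vanishes : ∀ b → VanishesUpTo b (unit (suc b))
unit-vanishes b       ℕ.z≤n       = refl
unit-vanishes (suc b) (ℕ.s≤s s≤b) = unit-vanishes b s≤b

-- Binomial coefficients

binomial : ℕ → Row
binomial M = pascal M (unit 0)

pascal-zero : ∀ M r → pascal M r 0 ≡ r 0
pascal-zero zero    r = refl
pascal-zero (suc M) r = pascal-zero M r

-- Splitting the series r into `r 0` and x times the rest gives this rule; it replaces explicit sums
-- of binomial coefficients by induction on s.
pascal-suc : ∀ M r s → pascal M r (suc s) ≡ r 0 * binomial M (suc s) + pascal M (r ∘ suc) s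
pascal-suc zero    r s    = sym (trans (cong (_+ r (suc s)) (ℤ.*-zeroʳ (r 0))) (ℤ.+-identityˡ _))
pascal-suc (suc M) r zero = begin
  pascal M r 0 + pascal M r 1
    ≡⟨ cong₂ _+_ (pascal-zero M r) (pascal-suc M r 0) ⟩
  r 0 + (r 0 * binomial M 1 + pascal M (r ∘ suc) 0)
    ≡⟨ rearrange (r 0) (binomial M 1) (pascal M (r ∘ suc) 0) ⟩
  r 0 * (+ 1 + binomial M 1) + pascal M (r ∘ suc) 0
    ≡⟨ cong (λ c → r 0 * (c + binomial M 1) + pascal M (r ∘ suc) 0) (pascal-zero M (unit 0)) ⟨
  r 0 * (binomial M 0 + binomial M 1) + pascal M (r ∘ suc) 0 ∎
  where
  rearrange : ∀ a b c → a + (a * b + c) ≡ a * (+ 1 + b) + c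
  rearrange = solve-∀
pascal-suc (suc M) r (suc s) =
  trans (cong₂ _+_ (pascal-suc M r s) (pascal-suc M r (suc s)))
        (rearrange (r 0) (binomial M (suc s)) (binomial M (suc (suc s)))
                   (pascal M (r ∘ suc) s) (pascal M (r ∘ suc) (suc s)))
  where
  rearrange : ∀ a b b′ c c′ → (a * b + c) + (a * b′ + c′) ≡ a * (b + b′) + (c + c′)
  rearrange = solve-∀

-- The difference is taken in ℤ, so that s > M is covered as well: both sides are then zero.
binomial-absorption : ∀ M s → + suc s * binomial M (suc s) ≡ (+ M - + s) * binomial M s
binomial-absorption zero    zero    = refl
binomial-absorption zero    (suc s) = trans (ℤ.*-zeroʳ (+ suc (suc s))) (sym (ℤ.*-zeroʳ (+ 0 - + suc s)))
binomial-absorption (suc M) zero    = begin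
  + 1 * (binomial M 0 + binomial M 1)
    ≡⟨ ℤ.*-distribˡ-+ (+ 1) (binomial M 0) (binomial M 1) ⟩
  + 1 * binomial M 0 + + 1 * binomial M 1
    ≡⟨ cong (_+_ (+ 1 * binomial M 0)) (binomial-absorption M zero) ⟩
  + 1 * binomial M 0 + (+ M - + 0) * binomial M 0
    ≡⟨ rearrange (+ M) (binomial M 0) ⟩
  (+ suc M - + 0) * binomial M 0 ∎
  where
  rearrange : ∀ m c → + 1 * c + (m - + 0) * c ≡ (+ 1 + m - + 0) * c
  rearrange = solve-∀
binomial-absorption (suc M) (suc s) = begin
  + suc (suc s) * (binomial M (suc s) + binomial M (suc (suc s)))
    ≡⟨ ℤ.*-distribˡ-+ (+ suc (suc s)) (binomial M (suc s)) _ ⟩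
  + suc (suc s) * binomial M (suc s) + + suc (suc s) * binomial M (suc (suc s))
    ≡⟨ cong (_+_ (+ suc (suc s) * binomial M (suc s))) (binomial-absorption M (suc s)) ⟩
  + suc (suc s) * binomial M (suc s) + (+ M - + suc s) * binomial M (suc s)
    ≡⟨ rearrange₁ (+ M) (+ s) (binomial M (suc s)) ⟩
  + suc s * binomial M (suc s) + (+ M - + s) * binomial M (suc s)
    ≡⟨ cong (_+ (+ M - + s) * binomial M (suc s)) (binomial-absorption M s) ⟩
  (+ M - + s) * binomial M s + (+ M - + s) * binomial M (suc s)
    ≡⟨ rearrange₂ (+ M) (+ s) (binomial M s) (binomial M (suc s)) ⟩
  (+ suc M - + suc s) * (binomial M s + binomial M (suc s)) ∎
  where
  rearrange₁ : ∀ m s c → (+ 1 + (+ 1 + s)) * c + (m - (+ 1 + s)) * c ≡ (+ 1 + s) * c + (m - s) * c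
  rearrange₁ = solve-∀
  rearrange₂ : ∀ m s c c′ → (m - s) * c + (m - s) * c′ ≡ (+ 1 + m - (+ 1 + s)) * (c + c′)
  rearrange₂ = solve-∀

-- Reflected products of Pascal rows

-- Row index s + 1 stands for the lower index s of a binomial coefficient, so
-- that the lower index -1 is available; J stands for j + 1, M for the number of
-- steps.  With rows C(M,s-b) and C(M,s-c) this is
-- C(M,k-b) C(M,k+j-c) - C(M,k-1-c) C(M,k+j+1-b).
term : Row → Row → ℕ → ℕ → ℕ → ℤ
term d a M k J =
  pascal M d (suc k) * pascal M a (k ℕ.+ J) - pascal M a k * pascal M d (suc k ℕ.+ J)

-- J = 0 is the line y = -1, fixed by the reflection; there the two products have the same factors.
term-boundary : ∀ d a M k → term d a M k 0 ≡ + 0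
term-boundary d a M k rewrite ℕ.+-identityʳ k = commute (pascal M d (suc k)) (pascal M a k)
  where
  commute : ∀ x y → x * y - y * x ≡ + 0
  commute = solve-∀

-- Pascal's rule in both factors yields four products, one per Gessel step: the summands are the
-- predecessors by SW, NE, E and W in this order. As x = M - 2k, the predecessors with larger x are
-- those with k lowered by one.
term-step : ∀ d a M k J →
  term d a (suc M) (suc k) (suc J) ≡
  term d a M k (suc (suc J)) + (term d a M (suc k) J + (term d a M (suc k) (suc J) + term d a M k (suc J)))
term-step d a M k J
  rewrite ℕ.+-suc k (suc J) | ℕ.+-suc k J =
  expand (pascal M d (suc k)) (pascal M d (suc (suc k)))
         (pascal M d (suc (suc (k ℕ.+ J)))) (pascal M d (suc (suc (suc (k ℕ.+ J)))))
         (pascal M a k) (pascal M a (suc k))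
         (pascal M a (suc (k ℕ.+ J))) (pascal M a (suc (suc (k ℕ.+ J))))
  where
  expand : ∀ d₀ d₁ d₂ d₃ a₀ a₁ a₂ a₃ →
    (d₀ + d₁) * (a₂ + a₃) - (a₀ + a₁) * (d₂ + d₃) ≡
    (d₀ * a₃ - a₀ * d₃) + ((d₁ * a₂ - a₁ * d₂) + ((d₁ * a₃ - a₁ * d₃) + (d₀ * a₂ - a₀ * d₂)))
  expand = solve-∀

-- source (suc b) is the row of weights that makes solution (suc b) vanish at
-- x = -1 for k = b + 1, where the number of steps is 2k - 1 = 2b + 1.
source : ℕ → Row
solution : ℕ → ℕ → ℕ → ℕ → ℤ

source zero    = unit 1
source (suc b) =
  unpascal (suc (b ℕ.+ b)) (λ s → - solution b (suc (b ℕ.+ b)) (suc b) (s ℕ.∸ suc b))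

solution zero    M k J = term (unit 1) (source zero) M k J
solution (suc b) M k J = solution b M k J + term (unit (suc (suc b))) (source (suc b)) M k J

solution-boundary : ∀ b M k → solution b M k 0 ≡ + 0
solution-boundary zero    M k = term-boundary (unit 1) (source 0) M k
solution-boundary (suc b) M k =
  cong₂ _+_ (solution-boundary b M k) (term-boundary (unit (suc (suc b))) (source (suc b)) M k)

solution-step : ∀ b M k J →
  solution b (suc M) (suc k) (suc J) ≡
  solution b M k (suc (suc J)) + (solution b M (suc k) J + (solution b M (suc k) (suc J) + solution b M k (suc J)))
solution-step zero    M k J = term-step (unit 1) (source 0) M k J
solution-step (suc b) M k J =
  trans (cong₂ _+_ (solution-step b M k J) (term-step (unit (suc (suc b))) (source (suc b)) M k J))
        (rearrange (solution b M k (suc (suc J))) (solution b M (suc k) J)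
                   (solution b M (suc k) (suc J)) (solution b M k (suc J)) (t k (suc (suc J)))
                   (t (suc k) J) (t (suc k) (suc J)) (t k (suc J)))
  where
  t : ℕ → ℕ → ℤ
  t = term (unit (suc (suc b))) (source (suc b)) M
  rearrange : ∀ f₁ f₂ f₃ f₄ t₁ t₂ t₃ t₄ →
    (f₁ + (f₂ + (f₃ + f₄))) + (t₁ + (t₂ + (t₃ + t₄))) ≡
    (f₁ + t₁) + ((f₂ + t₂) + ((f₃ + t₃) + (f₄ + t₄)))
  rearrange = solve-∀

-- For s up to `suc b` the truncated difference is 0, hence on the line y = -1, where `solution` is
-- zero; dividing by powers of 1 + x keeps these zeros.
source-vanishes : ∀ b → VanishesUpTo (suc b) (source (suc b))
source-vanishes b = unpascal-vanishes (suc (b ℕ.+ b)) target-vanishes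
  where
  target-vanishes : VanishesUpTo (suc b) (λ s → - solution b (suc (b ℕ.+ b)) (suc b) (s ℕ.∸ suc b))
  target-vanishes {s} s≤b =
    cong -_ (trans (cong (solution b (suc (b ℕ.+ b)) (suc b)) (ℕ.m≤n⇒m∸n≡0 s≤b))
                   (solution-boundary b (suc (b ℕ.+ b)) (suc b)))

-- At k = b the rows in front are read at `suc b` and b, before the first nonzero weight of either,
-- so each product has a zero factor.
correction-vanishes : ∀ b M J → term (unit (suc (suc b))) (source (suc b)) M b J ≡ + 0
correction-vanishes b M J =
  cong₂ (λ x y → x * pascal M (source (suc b)) (b ℕ.+ J) - y * pascal M (unit (suc (suc b))) (suc b ℕ.+ J))
        (pascal-vanishes {r = unit (suc (suc b))} M (unit-vanishes (suc b)) ℕ.≤-refl)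
        (pascal-vanishes {r = source (suc b)} M (source-vanishes b) (ℕ.n≤1+n b))

solution-stable : ∀ b M J → solution (suc b) M b J ≡ solution b M b J
solution-stable b M J =
  trans (cong (_+_ (solution b M b J)) (correction-vanishes b M J)) (ℤ.+-identityʳ _)

-- In the correction the first factor is the leading 1 and the reflected product is zero. What
-- remains is an entry of the row grown from `source (suc b)`, which was defined to be the negative
-- of `solution b`.
solution-left : ∀ b J → solution (suc b) (suc (b ℕ.+ b)) (suc b) J ≡ + 0
solution-left b J = begin
  solution b M (suc b) J + (pascal M u (suc (suc b)) * pascal M (source (suc b)) (suc b ℕ.+ J)
    - pascal M (source (suc b)) (suc b) * pascal M u (suc (suc b) ℕ.+ J))
    ≡⟨ cong₂ (λ x y → solution b M (suc b) J + (x * pascal M (source (suc b)) (suc b ℕ.+ J) - y * pascal M u (suc (suc b) ℕ.+ J)))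
         (trans (pascal-leading {r = u} M (unit-vanishes (suc b))) (unit-diagonal (suc (suc b))))
         (pascal-vanishes {r = source (suc b)} M (source-vanishes b) ℕ.≤-refl) ⟩
  solution b M (suc b) J + (+ 1 * pascal M (source (suc b)) (suc b ℕ.+ J) - + 0 * pascal M u (suc (suc b) ℕ.+ J))
    ≡⟨ cong (λ x → solution b M (suc b) J + (+ 1 * x - + 0 * pascal M u (suc (suc b) ℕ.+ J)))
         -- The row index is `suc b + J`; the subtraction in `source` recovers J from it.
         (trans (pascal-unpascal M _ (suc b ℕ.+ J)) (cong (λ j → - solution b M (suc b) j) (ℕ.m+n∸m≡n (suc b) J))) ⟩
  solution b M (suc b) J + (+ 1 * - solution b M (suc b) J - + 0 * pascal M u (suc (suc b) ℕ.+ J))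
    ≡⟨ cancel (solution b M (suc b) J) (pascal M u (suc (suc b) ℕ.+ J)) ⟩
  + 0 ∎
  where
  M : ℕ
  M = suc (b ℕ.+ b)
  u : Row
  u = unit (suc (suc b))
  cancel : ∀ x y → x + (+ 1 * - x - + 0 * y) ≡ + 0
  cancel = solve-∀

-- Integer polynomial functions on ℕ

-- IsPolynomial d c g: g is the restriction to ℕ of an integer polynomial of
-- degree at most d whose coefficient at x^d is c.
data IsPolynomial : ℕ → ℤ → (ℕ → ℤ) → Set where
  constant : ∀ {c g} → (∀ n → g n ≡ c) → IsPolynomial 0 c g
  horner   : ∀ {d c g} a {q} → IsPolynomial d c q → (∀ n → g n ≡ a + + n * q n) →
             IsPolynomial (suc d) c g

polynomial-cong : ∀ {d c g h} → g ≗ h → IsPolynomial d c g → IsPolynomial d c h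
polynomial-cong g≗h (constant eq)   = constant λ n → trans (sym (g≗h n)) (eq n)
polynomial-cong g≗h (horner a q eq) = horner a q λ n → trans (sym (g≗h n)) (eq n)

polynomial-+ : ∀ {d c c′ g h} → IsPolynomial d c g → IsPolynomial d c′ h →
               IsPolynomial d (c + c′) (λ n → g n + h n)
polynomial-+ (constant eq) (constant eq′) = constant λ n → cong₂ _+_ (eq n) (eq′ n)
polynomial-+ (horner a {q} p eq) (horner a′ {q′} p′ eq′) =
  horner (a + a′) (polynomial-+ p p′) λ n →
    trans (cong₂ _+_ (eq n) (eq′ n)) (rearrange a a′ (+ n) (q n) (q′ n))
  where
  rearrange : ∀ a a′ n q q′ → (a + n * q) + (a′ + n * q′) ≡ (a + a′) + n * (q + q′)
  rearrange = solve-∀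

polynomial-scale : ∀ {d c g} z → IsPolynomial d c g → IsPolynomial d (z * c) (λ n → z * g n)
polynomial-scale z (constant eq) = constant λ n → cong (z *_) (eq n)
polynomial-scale z (horner a {q} p eq) =
  horner (z * a) (polynomial-scale z p) λ n →
    trans (cong (z *_) (eq n)) (rearrange z a (+ n) (q n))
  where
  rearrange : ∀ z a n q → z * (a + n * q) ≡ z * a + n * (z * q)
  rearrange = solve-∀

-- Pads with a zero leading coefficient, so that summands of different degrees fit `polynomial-+`.
polynomial-suc-degree : ∀ {d c g} → IsPolynomial d c g → IsPolynomial (suc d) (+ 0) g
polynomial-suc-degree {c = c} (constant eq) =
  horner c {λ _ → + 0} (constant λ _ → refl) λ n →
    trans (eq n) (sym (trans (cong (_+_ c) (ℤ.*-zeroʳ (+ n))) (ℤ.+-identityʳ c)))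
polynomial-suc-degree (horner a p eq) = horner a (polynomial-suc-degree p) eq

polynomial-raise : ∀ {d c g} e → IsPolynomial d c g → IsPolynomial (suc (e ℕ.+ d)) (+ 0) g
polynomial-raise zero    p = polynomial-suc-degree p
polynomial-raise (suc e) p = polynomial-suc-degree (polynomial-raise e p)

polynomial-* : ∀ {d e c c′ g h} → IsPolynomial d c g → IsPolynomial e c′ h →
               IsPolynomial (d ℕ.+ e) (c * c′) (λ n → g n * h n)
polynomial-* {c = c} {h = h} (constant eq) p′ =
  polynomial-cong (λ n → cong (_* h n) (sym (eq n))) (polynomial-scale c p′)
polynomial-* {suc d} {h = h} (horner a {q} p eq) p′ =
  polynomial-cong
    (λ n → trans (rearrange a (+ n) (q n) (h n)) (cong (_* h n) (sym (eq n))))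
    (subst (λ c → IsPolynomial _ c (λ n → a * h n + (+ 0 + + n * (q n * h n)))) (ℤ.+-identityˡ _)
      (polynomial-+ (polynomial-raise d (polynomial-scale a p′))
                    (horner (+ 0) (polynomial-* p p′) λ _ → refl)))
  where
  rearrange : ∀ a n q h → a * h + (+ 0 + n * (q * h)) ≡ (a + n * q) * h
  rearrange = solve-∀

-- Replacing n by n + 1 in a + n q(n) adds q(n + 1), which has lower degree and leaves the leading
-- coefficient alone.
polynomial-shift : ∀ {d c g} → IsPolynomial d c g → IsPolynomial d c (g ∘ suc)
polynomial-shift (constant eq) = constant (eq ∘ suc)
polynomial-shift (horner {c = c} a {q} p eq) =
  polynomial-cong
    (λ n → trans (rearrange a (+ n) (q (suc n))) (sym (eq (suc n))))
    (subst (λ c → IsPolynomial _ c (λ n → (a + + n * q (suc n)) + q (suc n))) (ℤ.+-identityʳ c)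
      (polynomial-+ (horner a p′ λ _ → refl) (polynomial-suc-degree p′)))
  where
  p′ = polynomial-shift p
  rearrange : ∀ a n q → (a + n * q) + q ≡ a + (+ 1 + n) * q
  rearrange = solve-∀

polynomial-linear : ∀ a → IsPolynomial 1 (+ 1) (λ n → + n + a)
polynomial-linear a =
  horner a {λ _ → + 1} (constant λ _ → refl) λ n → rearrange a (+ n)
  where
  rearrange : ∀ a n → n + a ≡ a + n * + 1
  rearrange = solve-∀

-- In Horner form the constant coefficient is the value at 0; once it is zero, the inner polynomial
-- is the quotient by n.
polynomial-root : ∀ {d c g} → IsPolynomial (suc d) c g → g 0 ≡ + 0 →
                  ∃ λ q → IsPolynomial d c q × (∀ n → g n ≡ + n * q n)
polynomial-root {g = g} (horner a {q} p eq) g0≡0 = q , p , λ n →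
  trans (eq n) (trans (cong (_+ + n * q n) a≡0) (ℤ.+-identityˡ _))
  where
  a≡0 : a ≡ + 0
  a≡0 = trans (sym (ℤ.+-identityʳ a)) (trans (sym (eq 0)) g0≡0)

polynomial-coefficients : ∀ {d g} → IsPolynomial d (+ 1) g →
  ∃ λ (p : Polyℤ) → HasLeadingTerm-x^ d p × (∀ n → g n ≡ eval p (+ n))
polynomial-coefficients (constant eq) =
  + 1 ∷ [] , (refl , λ { (suc i) _ → refl }) ,
  λ n → trans (eq n) (cong (_+_ (+ 1)) (sym (ℤ.*-zeroʳ (+ n))))
polynomial-coefficients (horner a q eq) with polynomial-coefficients q
... | p , (leading , above) , eval-p =
  a ∷ p , (leading , λ { (suc i) (ℕ.s≤s d<i) → above i d<i }) ,
  λ n → trans (eq n) (cong (λ x → a + + n * x) (eval-p n))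

-- Factorial multiples of Pascal rows as polynomials in n

-- This is a falling factorial; absorption supplies one linear factor n + o - s at a time.
factorial-binomial : ∀ o s → IsPolynomial s (+ 1) (λ n → + (s !) * binomial (n ℕ.+ o) s)
factorial-binomial o zero    = constant λ n → cong (_*_ (+ 1)) (pascal-zero (n ℕ.+ o) (unit 0))
factorial-binomial o (suc s) =
  polynomial-cong eq (polynomial-* (polynomial-linear (+ o - + s)) (factorial-binomial o s))
  where
  rearrange₁ : ∀ n o s f c → (n + (o - s)) * (f * c) ≡ f * ((n + o - s) * c)
  rearrange₁ = solve-∀
  rearrange₂ : ∀ f t c → f * (t * c) ≡ (t * f) * c
  rearrange₂ = solve-∀
  eq : ∀ n → (+ n + (+ o - + s)) * (+ (s !) * binomial (n ℕ.+ o) s) ≡ + (suc s !) * binomial (n ℕ.+ o) (suc s)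
  eq n = begin
    (+ n + (+ o - + s)) * (+ (s !) * binomial (n ℕ.+ o) s)
      ≡⟨ rearrange₁ (+ n) (+ o) (+ s) (+ (s !)) (binomial (n ℕ.+ o) s) ⟩
    + (s !) * ((+ (n ℕ.+ o) - + s) * binomial (n ℕ.+ o) s)
      ≡⟨ cong (_*_ (+ (s !))) (binomial-absorption (n ℕ.+ o) s) ⟨
    + (s !) * (+ suc s * binomial (n ℕ.+ o) (suc s))
      ≡⟨ rearrange₂ (+ (s !)) (+ suc s) (binomial (n ℕ.+ o) (suc s)) ⟩
    (+ suc s * + (s !)) * binomial (n ℕ.+ o) (suc s)
      ≡⟨ cong (_* binomial (n ℕ.+ o) (suc s)) (ℤ.pos-* (suc s) (s !)) ⟨
    + (suc s !) * binomial (n ℕ.+ o) (suc s) ∎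

-- Only the weight `r 0` meets C(M, s); a weight `r i` with i > 0 meets C(M, s - i), of lower
-- degree, and s! clears its denominator too.
factorial-pascal : ∀ o s r → IsPolynomial s (r 0) (λ n → + (s !) * pascal (n ℕ.+ o) r s)
factorial-pascal o zero    r =
  constant λ n → trans (ℤ.*-identityˡ _) (pascal-zero (n ℕ.+ o) r)
factorial-pascal o (suc s) r =
  subst (λ c → IsPolynomial (suc s) c (λ n → + (suc s !) * pascal (n ℕ.+ o) r (suc s)))
    (trans (ℤ.+-identityʳ _) (ℤ.*-identityʳ (r 0)))
    (polynomial-cong eq
      (polynomial-+ (polynomial-scale (r 0) (factorial-binomial o (suc s)))
                    (polynomial-suc-degree (polynomial-scale (+ suc s) (factorial-pascal o s (r ∘ suc))))))
  where
  rearrange : ∀ z f t b p → z * ((t * f) * b) + t * (f * p) ≡ (t * f) * (z * b + p)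
  rearrange = solve-∀
  eq : ∀ n → r 0 * (+ (suc s !) * binomial (n ℕ.+ o) (suc s)) + + suc s * (+ (s !) * pascal (n ℕ.+ o) (r ∘ suc) s)
           ≡ + (suc s !) * pascal (n ℕ.+ o) r (suc s)
  eq n = begin
    r 0 * (+ (suc s !) * binomial M (suc s)) + + suc s * (+ (s !) * pascal M (r ∘ suc) s)
      ≡⟨ cong (λ f → r 0 * (f * binomial M (suc s)) + + suc s * (+ (s !) * pascal M (r ∘ suc) s)) (ℤ.pos-* (suc s) (s !)) ⟩
    r 0 * ((+ suc s * + (s !)) * binomial M (suc s)) + + suc s * (+ (s !) * pascal M (r ∘ suc) s)
      ≡⟨ rearrange (r 0) (+ (s !)) (+ suc s) (binomial M (suc s)) (pascal M (r ∘ suc) s) ⟩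
    (+ suc s * + (s !)) * (r 0 * binomial M (suc s) + pascal M (r ∘ suc) s)
      ≡⟨ cong₂ _*_ (ℤ.pos-* (suc s) (s !)) (pascal-suc M r s) ⟨
    + (suc s !) * pascal M r (suc s) ∎
    where
    M : ℕ
    M = n ℕ.+ o

-- Only the weight at 0 would bring in C(M, s + 1). Without it, s! is enough and the degree drops to
-- s.
factorial-pascal-suc : ∀ o s r → r 0 ≡ + 0 →
  IsPolynomial s (r 1) (λ n → + (s !) * pascal (n ℕ.+ o) r (suc s))
factorial-pascal-suc o s r r0≡0 =
  polynomial-cong (λ n → cong (_*_ (+ (s !))) (eq n)) (factorial-pascal o s (r ∘ suc))
  where
  eq : ∀ n → pascal (n ℕ.+ o) (r ∘ suc) s ≡ pascal (n ℕ.+ o) r (suc s)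
  eq n = sym (begin
    pascal (n ℕ.+ o) r (suc s)                                          ≡⟨ pascal-suc (n ℕ.+ o) r s ⟩
    r 0 * binomial (n ℕ.+ o) (suc s) + pascal (n ℕ.+ o) (r ∘ suc) s     ≡⟨ cong (λ x → x * binomial (n ℕ.+ o) (suc s) + pascal (n ℕ.+ o) (r ∘ suc) s) r0≡0 ⟩
    + 0 * binomial (n ℕ.+ o) (suc s) + pascal (n ℕ.+ o) (r ∘ suc) s     ≡⟨ ℤ.+-identityˡ _ ⟩
    pascal (n ℕ.+ o) (r ∘ suc) s                                        ∎)

-- J = 1 is the axis j = 0. The first product uses k! twice and leaves a factor k + 1; the reflected
-- one uses (k - 1)! and (k + 1)! and leaves a factor k. Hence the leading coefficient is
-- `d 1 * a 1` times (k + 1) - k.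
term-polynomial : ∀ o d a b → d 0 ≡ + 0 → a 0 ≡ + 0 →
  IsPolynomial (suc b ℕ.+ suc b) (d 1 * a 1)
    (λ n → + (suc b ! ℕ.* suc (suc b) !) * term d a (n ℕ.+ o) (suc b) 1)
term-polynomial o d a b d0≡0 a0≡0 =
  subst (λ c → IsPolynomial (k ℕ.+ k) c (λ n → + (k ! ℕ.* suc k !) * term d a (n ℕ.+ o) k 1))
    (leading (d 1) (a 1) (+ k))
    (polynomial-cong eq
      (polynomial-+ (polynomial-* (factorial-pascal-suc o k d d0≡0)
                                  (polynomial-scale (+ suc k) (factorial-pascal-suc o k a a0≡0)))
                    (polynomial-scale (- + 1)
                      (subst (λ e → IsPolynomial e ((+ k * a 1) * d 1) second) (ℕ.+-suc b k)
                        (polynomial-* (polynomial-scale (+ k) (factorial-pascal-suc o b a a0≡0))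
                                      (factorial-pascal-suc o (suc k) d d0≡0))))))
  where
  k : ℕ
  k = suc b
  second : ℕ → ℤ
  second n = (+ k * (+ (b !) * pascal (n ℕ.+ o) a k)) * (+ (suc k !) * pascal (n ℕ.+ o) d (suc (suc k)))
  leading : ∀ x y k → x * ((+ 1 + k) * y) + - + 1 * ((k * y) * x) ≡ x * y
  leading = solve-∀
  rearrange : ∀ f k x y z w →
    ((k * f) * x) * ((+ 1 + k) * ((k * f) * y)) + - + 1 * ((k * (f * z)) * (((+ 1 + k) * (k * f)) * w)) ≡
    ((k * f) * ((+ 1 + k) * (k * f))) * (x * y - z * w)
  rearrange = solve-∀
  scaled : ∀ f k x y z w {f′ f″ K} → f′ ≡ k * f → f″ ≡ (+ 1 + k) * f′ → K ≡ f′ * f″ →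
    (f′ * x) * ((+ 1 + k) * (f′ * y)) + - + 1 * ((k * (f * z)) * (f″ * w)) ≡ K * (x * y - z * w)
  scaled f k x y z w refl refl refl = rearrange f k x y z w
  eq : ∀ n → (+ (k !) * pascal (n ℕ.+ o) d (suc k)) * (+ suc k * (+ (k !) * pascal (n ℕ.+ o) a (suc k)))
             + - + 1 * second n
           ≡ + (k ! ℕ.* suc k !) * term d a (n ℕ.+ o) k 1
  -- At J = 1 the row indices in `term` contain `b + 1`, which does not reduce to `suc b`.
  eq n rewrite ℕ.+-comm b 1 =
    scaled (+ (b !)) (+ k) (pascal (n ℕ.+ o) d (suc k)) (pascal (n ℕ.+ o) a (suc k))
           (pascal (n ℕ.+ o) a k) (pascal (n ℕ.+ o) d (suc (suc k)))
           (ℤ.pos-* k (b !)) (ℤ.pos-* (suc k) (k !)) (ℤ.pos-* (k !) (suc k !))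

-- The initial term has weight 1 at index 1 in both rows. In every correction the `unit` row is zero
-- at index 1, so nothing is added to the leading coefficient.
solution-polynomial : ∀ o b i →
  IsPolynomial (suc b ℕ.+ suc b) (+ 1)
    (λ n → + (suc b ! ℕ.* suc (suc b) !) * solution i (n ℕ.+ o) (suc b) 1)
solution-polynomial o b zero    = term-polynomial o (unit 1) (source 0) b refl refl
solution-polynomial o b (suc i) =
  polynomial-cong (λ n → sym (ℤ.*-distribˡ-+ (+ (suc b ! ℕ.* suc (suc b) !)) (solution i (n ℕ.+ o) (suc b) 1) _))
    (polynomial-+ (solution-polynomial o b i)
                  (term-polynomial o (unit (suc (suc i))) (source (suc i)) b refl
                    (source-vanishes i ℕ.z≤n)))

-- Gessel walks

count : ℕ → Point → Point → ℕ
count m p q = length (filter (isGesselWalk? p q) (allWalks m))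

length-filter-map : ∀ {A B : Set} {P : B → Set} (P? : Decidable P) (f : A → B) xs →
  length (filter P? (map f xs)) ≡ length (filter (P? ∘ f) xs)
length-filter-map P? f []       = refl
length-filter-map P? f (x ∷ xs) with ih ← length-filter-map P? f xs | does (P? (f x))
... | true  = cong suc ih
... | false = ih

length-filter-++ : ∀ {A : Set} {P : A → Set} (P? : Decidable P) xs ys →
  length (filter P? (xs ++ ys)) ≡ length (filter P? xs) ℕ.+ length (filter P? ys)
length-filter-++ P? xs ys = trans (cong length (filter-++ P? xs ys)) (length-++ (filter P? xs))

sumSteps : (Step → ℕ) → ℕ
sumSteps f = f W ℕ.+ (f NE ℕ.+ (f E ℕ.+ f SW))

sumSteps-cong : ∀ {f g} → f ≗ g → sumSteps f ≡ sumSteps g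
sumSteps-cong eq = cong₂ ℕ._+_ (eq W) (cong₂ ℕ._+_ (eq NE) (cong₂ ℕ._+_ (eq E) (eq SW)))

sumSteps-swap : ∀ (f : Step → Step → ℕ) →
  sumSteps (λ s → sumSteps (f s)) ≡ sumSteps (λ t → sumSteps (λ s → f s t))
sumSteps-swap f =
  lemma (f W W) (f W NE) (f W E) (f W SW) (f NE W) (f NE NE) (f NE E) (f NE SW)
        (f E W) (f E NE) (f E E) (f E SW) (f SW W) (f SW NE) (f SW E) (f SW SW)
  where
  lemma : ∀ a₁ a₂ a₃ a₄ b₁ b₂ b₃ b₄ c₁ c₂ c₃ c₄ d₁ d₂ d₃ d₄ →
    (a₁ ℕ.+ (a₂ ℕ.+ (a₃ ℕ.+ a₄))) ℕ.+ ((b₁ ℕ.+ (b₂ ℕ.+ (b₃ ℕ.+ b₄))) ℕ.+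
      ((c₁ ℕ.+ (c₂ ℕ.+ (c₃ ℕ.+ c₄))) ℕ.+ (d₁ ℕ.+ (d₂ ℕ.+ (d₃ ℕ.+ d₄))))) ≡
    (a₁ ℕ.+ (b₁ ℕ.+ (c₁ ℕ.+ d₁))) ℕ.+ ((a₂ ℕ.+ (b₂ ℕ.+ (c₂ ℕ.+ d₂))) ℕ.+
      ((a₃ ℕ.+ (b₃ ℕ.+ (c₃ ℕ.+ d₃))) ℕ.+ (a₄ ℕ.+ (b₄ ℕ.+ (c₄ ℕ.+ d₄)))))
  lemma = ℕ.solve-∀

count-outside-start : ∀ m {p} q → ¬ InQuadrant p → count m p q ≡ 0
count-outside-start m {p} q p∉Q =
  cong length (filter-none (isGesselWalk? p q) (universal (λ w → p∉Q ∘ start w ∘ proj₁) (allWalks m)))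
  where
  start : ∀ {m} (w : Walk m) → StaysInQuadrant p w → InQuadrant p
  start []      = id
  start (s ∷ w) = proj₁

endpoint-inQuadrant : ∀ {m} p (w : Walk m) → StaysInQuadrant p w → InQuadrant (endpoint p w)
endpoint-inQuadrant p []      p∈Q       = p∈Q
endpoint-inQuadrant p (s ∷ w) (_ , stays) = endpoint-inQuadrant (move p s) w stays

count-outside-end : ∀ m p {q} → ¬ InQuadrant q → count m p q ≡ 0
count-outside-end m p {q} q∉Q =
  cong length (filter-none (isGesselWalk? p q) (universal (λ { w (stays , refl) → q∉Q (endpoint-inQuadrant p w stays) }) (allWalks m)))

count-first : ∀ m {p} q → InQuadrant p → count (suc m) p q ≡ sumSteps (λ s → count m (move p s) q)
count-first m {p} q p∈Q = begin
  count (suc m) p q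
    ≡⟨ split W _ ⟩
  block W ℕ.+ length (filter P? (map (NE ∷_) ws ++ (map (E ∷_) ws ++ (map (SW ∷_) ws ++ []))))
    ≡⟨ cong (block W ℕ.+_) (split NE _) ⟩
  block W ℕ.+ (block NE ℕ.+ length (filter P? (map (E ∷_) ws ++ (map (SW ∷_) ws ++ []))))
    ≡⟨ cong (λ x → block W ℕ.+ (block NE ℕ.+ x)) (split E _) ⟩
  block W ℕ.+ (block NE ℕ.+ (block E ℕ.+ length (filter P? (map (SW ∷_) ws ++ []))))
    ≡⟨ cong (λ x → block W ℕ.+ (block NE ℕ.+ (block E ℕ.+ x))) (trans (split SW []) (ℕ.+-identityʳ _)) ⟩
  sumSteps block
    ≡⟨ sumSteps-cong tails ⟩
  sumSteps (λ s → count m (move p s) q) ∎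
  where
  ws = allWalks m
  P? : Decidable (IsGesselWalk {suc m} p q)
  P? = isGesselWalk? p q
  block : Step → ℕ
  block s = length (filter P? (map (s ∷_) ws))
  split : ∀ s ys → length (filter P? (map (s ∷_) ws ++ ys)) ≡ block s ℕ.+ length (filter P? ys)
  split s ys = length-filter-++ P? (map (s ∷_) ws) ys
  tails : ∀ s → block s ≡ count m (move p s) q
  tails s = trans (length-filter-map P? (s ∷_) ws)
    (cong length (filter-≐ (P? ∘ (s ∷_)) (isGesselWalk? (move p s) q)
      (map₁ proj₂ , map₁ (p∈Q ,_)) ws))

stepBack : Point → Step → Point
stepBack (i , j) W  = i + + 1 , j
stepBack (i , j) NE = i - + 1 , j - + 1
stepBack (i , j) E  = i - + 1 , j
stepBack (i , j) SW = i + + 1 , j + + 1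

private
  +1-1 : ∀ i → i + + 1 - + 1 ≡ i
  +1-1 = solve-∀
  -1+1 : ∀ i → i - + 1 + + 1 ≡ i
  -1+1 = solve-∀

move-stepBack : ∀ q s → move (stepBack q s) s ≡ q
move-stepBack (i , j) W  = cong (_, j) (+1-1 i)
move-stepBack (i , j) NE = cong₂ _,_ (-1+1 i) (-1+1 j)
move-stepBack (i , j) E  = cong (_, j) (-1+1 i)
move-stepBack (i , j) SW = cong₂ _,_ (+1-1 i) (+1-1 j)

stepBack-move : ∀ p s → stepBack (move p s) s ≡ p
stepBack-move (i , j) W  = cong (_, j) (-1+1 i)
stepBack-move (i , j) NE = cong₂ _,_ (+1-1 i) (+1-1 j)
stepBack-move (i , j) E  = cong (_, j) (+1-1 i)
stepBack-move (i , j) SW = cong₂ _,_ (-1+1 i) (-1+1 j)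

-- Walks are built from their first step, but the recurrence with fixed start concerns the last one.
-- Splitting off the first step on both sides and exchanging the two sums reduces m; for this the
-- start p has to vary.
count-last : ∀ m p {q} → InQuadrant q → count (suc m) p q ≡ sumSteps (λ s → count m p (stepBack q s))
count-last m p {q} q∈Q with inQuadrant? p
... | no p∉Q = trans (count-outside-start (suc m) q p∉Q)
                     (sym (sumSteps-cong (λ s → count-outside-start m (stepBack q s) p∉Q)))
-- For a single step s, moving p to q is the same as p being `stepBack q s`.
count-last zero p {q} q∈Q | yes p∈Q =
  trans (count-first 0 q p∈Q) (sumSteps-cong λ s →
    cong length (filter-≐ (isGesselWalk? (move p s) q) (isGesselWalk? p (stepBack q s))
      ( (λ { {[]} (_ , refl) → p∈Q , sym (stepBack-move p s) })
      , (λ { {[]} (_ , refl) → subst InQuadrant (sym (move-stepBack q s)) q∈Q , move-stepBack q s }))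
      (allWalks 0)))
count-last (suc m) p {q} q∈Q | yes p∈Q = begin
  count (suc (suc m)) p q
    ≡⟨ count-first (suc m) q p∈Q ⟩
  sumSteps (λ s → count (suc m) (move p s) q)
    ≡⟨ sumSteps-cong (λ s → count-last m (move p s) q∈Q) ⟩
  sumSteps (λ s → sumSteps (λ t → count m (move p s) (stepBack q t)))
    ≡⟨ sumSteps-swap (λ s t → count m (move p s) (stepBack q t)) ⟩
  sumSteps (λ t → sumSteps (λ s → count m (move p s) (stepBack q t)))
    ≡⟨ sumSteps-cong (λ t → count-first m (stepBack q t) p∈Q) ⟨
  sumSteps (λ t → count (suc m) p (stepBack q t)) ∎

-- Coordinates shifted by one, so that 0 stands for the forbidden line at -1.
coordinate : ℕ → ℤ
coordinate zero    = -[1+ 0 ]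
coordinate (suc n) = + n

coordinate-pred : ∀ n → coordinate (suc n) - + 1 ≡ coordinate n
coordinate-pred zero    = refl
coordinate-pred (suc n) = refl

coordinate-suc : ∀ n → coordinate (suc n) + + 1 ≡ coordinate (suc (suc n))
coordinate-suc n = cong +_ (ℕ.+-comm n 1)

shiftedCount : ℕ → ℕ → ℕ → ℕ
shiftedCount m N J = count m (+ 0 , + 0) (coordinate N , coordinate J)

shiftedCount-left : ∀ m J → shiftedCount m 0 J ≡ 0
shiftedCount-left m J = count-outside-end m (+ 0 , + 0) λ ()

shiftedCount-bottom : ∀ m N → shiftedCount m N 0 ≡ 0
shiftedCount-bottom m N = count-outside-end m (+ 0 , + 0) λ ()

shiftedCount-step : ∀ m N J → shiftedCount (suc m) (suc N) (suc J) ≡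
  shiftedCount m (suc (suc N)) (suc J) ℕ.+ (shiftedCount m N J ℕ.+
    (shiftedCount m N (suc J) ℕ.+ shiftedCount m (suc (suc N)) (suc (suc J))))
shiftedCount-step m N J
  rewrite sym (coordinate-pred N) | sym (coordinate-pred J) | sym (coordinate-suc N) | sym (coordinate-suc J) =
  count-last m (+ 0 , + 0) (ℤ.+≤+ z≤n , ℤ.+≤+ z≤n)

-- A step raises x by at most one; the extra `suc` comes from the shift of the coordinate.
shiftedCount-beyond : ∀ m {N} J → suc m ℕ.< N → shiftedCount m N J ≡ 0
shiftedCount-beyond m       {N}           zero    m<N       = shiftedCount-bottom m N
shiftedCount-beyond zero    {suc zero}    (suc J) (s≤s ())
shiftedCount-beyond zero    {suc (suc N)} (suc J) m<N       = refl
shiftedCount-beyond (suc m) {suc N}       (suc J) (s≤s m<N)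
  rewrite shiftedCount-step m N J
        | shiftedCount-beyond m (suc J) (ℕ.m≤n⇒m≤1+n (ℕ.m≤n⇒m≤1+n m<N))
        | shiftedCount-beyond m J m<N
        | shiftedCount-beyond m (suc J) m<N
        | shiftedCount-beyond m (suc (suc J)) (ℕ.m≤n⇒m≤1+n (ℕ.m≤n⇒m≤1+n m<N)) = refl

-- Agreement of the walk counts with `solution`

-- The case k = 0: each of the n steps must raise x, so only NE and E occur and the count is C(n,
-- j). In the term the first factor is C(n, 0) = 1, and the reflected product contains C(n, -1) = 0.
solution-axis : ∀ n J → + shiftedCount n (suc n) J ≡ solution 0 n 0 J
solution-axis n    zero    = trans (cong +_ (shiftedCount-bottom n (suc n))) (sym (solution-boundary 0 n 0))
solution-axis zero (suc zero) = refl
solution-axis zero (suc (suc J)) = refl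
solution-axis (suc n) (suc J) = begin
  + shiftedCount (suc n) (suc (suc n)) (suc J)
    ≡⟨ cong +_ (shiftedCount-step n (suc n) J) ⟩
  + (shiftedCount n (suc (suc (suc n))) (suc J) ℕ.+ (shiftedCount n (suc n) J ℕ.+
      (shiftedCount n (suc n) (suc J) ℕ.+ shiftedCount n (suc (suc (suc n))) (suc (suc J)))))
    -- The predecessors by W and SW are too far to the right to be reached in n steps.
    ≡⟨ cong₂ (λ x y → + (x ℕ.+ (shiftedCount n (suc n) J ℕ.+ (shiftedCount n (suc n) (suc J) ℕ.+ y))))
         (shiftedCount-beyond n (suc J) (ℕ.n≤1+n _)) (shiftedCount-beyond n (suc (suc J)) (ℕ.n≤1+n _)) ⟩
  + (shiftedCount n (suc n) J ℕ.+ (shiftedCount n (suc n) (suc J) ℕ.+ 0))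
    ≡⟨ cong (λ x → + (shiftedCount n (suc n) J ℕ.+ x)) (ℕ.+-identityʳ (shiftedCount n (suc n) (suc J))) ⟩
  + shiftedCount n (suc n) J + + shiftedCount n (suc n) (suc J)
    ≡⟨ cong₂ _+_ (trans (solution-axis n J) (row n J)) (trans (solution-axis n (suc J)) (row n (suc J))) ⟩
  pascal n (unit 1) J + pascal n (unit 1) (suc J)
    ≡⟨ row (suc n) (suc J) ⟨
  solution 0 (suc n) 0 (suc J) ∎
  where
  simplify : ∀ x y → + 1 * x - + 0 * y ≡ x
  simplify = solve-∀
  row : ∀ M J → solution 0 M 0 J ≡ pascal M (unit 1) J
  row M J =
    trans (cong₂ (λ x y → x * pascal M (unit 1) J - y * pascal M (unit 1) (suc J))
             (pascal-leading {r = unit 1} M (unit-vanishes 0))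
             (pascal-vanishes {r = unit 1} M (unit-vanishes 0) z≤n))
          (simplify (pascal M (unit 1) J) (pascal M (unit 1) (suc J)))

-- Induction on k and, for k = b + 1, on N: predecessors by W and SW have smaller k, those by E and
-- NE smaller N. In `count-solution-suc` the abscissa is N - 1, so that N + 2b + 1 steps are (N - 1)
-- + 2k, and the induction starts on the line x = -1.
count-solution : ∀ k n J → + shiftedCount (n ℕ.+ (k ℕ.+ k)) (suc n) J ≡ solution k (n ℕ.+ (k ℕ.+ k)) k J
count-solution-suc : ∀ b N J →
  + shiftedCount (N ℕ.+ suc (b ℕ.+ b)) N J ≡ solution (suc b) (N ℕ.+ suc (b ℕ.+ b)) (suc b) J

count-solution zero    n J rewrite ℕ.+-identityʳ n = solution-axis n J
count-solution (suc b) n J =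
  subst (λ m → + shiftedCount m (suc n) J ≡ solution (suc b) m (suc b) J)
        (trans (sym (ℕ.+-suc n _)) (cong (λ x → n ℕ.+ suc x) (sym (ℕ.+-suc b b))))
        (count-solution-suc b (suc n) J)

-- No walk ends at x = -1, and `source` was chosen to make the other side vanish there.
count-solution-suc b zero    J = trans (cong +_ (shiftedCount-left (suc (b ℕ.+ b)) J)) (sym (solution-left b J))
count-solution-suc b (suc N) zero =
  trans (cong +_ (shiftedCount-bottom (suc N ℕ.+ suc (b ℕ.+ b)) (suc N))) (sym (solution-boundary (suc b) _ (suc b)))
count-solution-suc b (suc N) (suc J) = begin
  + shiftedCount (suc M) (suc N) (suc J)
    ≡⟨ cong +_ (shiftedCount-step M N J) ⟩
  + shiftedCount M (suc (suc N)) (suc J) + (+ shiftedCount M N J +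
    (+ shiftedCount M N (suc J) + + shiftedCount M (suc (suc N)) (suc (suc J))))
    ≡⟨ cong₂ _+_ (previous (suc J)) (cong₂ _+_ (count-solution-suc b N J)
         (cong₂ _+_ (count-solution-suc b N (suc J)) (previous (suc (suc J))))) ⟩
  solution (suc b) M b (suc J) + (solution (suc b) M (suc b) J +
    (solution (suc b) M (suc b) (suc J) + solution (suc b) M b (suc (suc J))))
    ≡⟨ exchange (solution (suc b) M b (suc J)) (solution (suc b) M (suc b) J)
                (solution (suc b) M (suc b) (suc J)) (solution (suc b) M b (suc (suc J))) ⟩
  solution (suc b) M b (suc (suc J)) + (solution (suc b) M (suc b) J +
    (solution (suc b) M (suc b) (suc J) + solution (suc b) M b (suc J)))
    ≡⟨ solution-step (suc b) M b J ⟨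
  solution (suc b) (suc M) (suc b) (suc J) ∎
  where
  M = N ℕ.+ suc (b ℕ.+ b)
  exchange : ∀ x y z w → x + (y + (z + w)) ≡ w + (y + (z + x))
  exchange = solve-∀
  -- These predecessors have k = b, where the newest correction is zero.
  previous : ∀ J → + shiftedCount M (suc (suc N)) J ≡ solution (suc b) M b J
  previous J =
    trans (subst (λ m → + shiftedCount m (suc (suc N)) J ≡ solution b m b J)
                 (sym (ℕ.+-suc N (b ℕ.+ b))) (count-solution b (suc N) J))
          (sym (solution-stable b M J))

-- Division by n + 1 and the resulting polynomial

-- Unnormalised rationals reduce the equality to cross-multiplication and avoid the gcds hidden in
-- `_/_`.
quotient-integral : ∀ a b c n → a ℤ.* b ≡ + suc n ℤ.* c → (a / suc n) ℚ.* (b / 1) ≡ c / 1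
quotient-integral a b c n ab≡nc = ℚ.toℚᵘ-injective (≃-begin
  toℚᵘ ((a / suc n) ℚ.* (b / 1))      ≈⟨ ℚ.toℚᵘ-homo-* (a / suc n) (b / 1) ⟩
  toℚᵘ (a / suc n) ℚᵘ.* toℚᵘ (b / 1)  ≈⟨ ℚᵘ.*-cong (ℚ.toℚᵘ-fromℚᵘ (mkℚᵘ a n)) (ℚ.toℚᵘ-fromℚᵘ (mkℚᵘ b 0)) ⟩
  mkℚᵘ a n ℚᵘ.* mkℚᵘ b 0              ≈⟨ *≡* cross ⟩
  mkℚᵘ c 0                            ≈⟨ ℚ.toℚᵘ-fromℚᵘ (mkℚᵘ c 0) ⟨
  toℚᵘ (c / 1)                        ≃-∎)
  where
  open ℚᵘ.≃-Reasoning
    using (step-≈-⟩; step-≈-⟨)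
    renaming (begin_ to ≃-begin_; _∎ to _≃-∎)
  cross : (a ℤ.* b) ℤ.* + 1 ≡ c ℤ.* + suc (n ℕ.* 1)
  cross = trans (ℤ.*-identityʳ (a ℤ.* b)) (trans ab≡nc
    (trans (ℤ.*-comm (+ suc n) c) (cong (λ x → c ℤ.* + suc x) (sym (ℕ.*-identityʳ n)))))

F-solution : ∀ b n →
  + F (n ℕ.+ 2 ℕ.* suc b) (+ n) (+ 0) ≡ solution (suc b) (suc n ℕ.+ suc (b ℕ.+ b)) (suc b) 1
F-solution b n =
  trans (cong (λ m → + F m (+ n) (+ 0)) (sym steps≡)) (count-solution-suc b (suc n) 1)
  where
  steps≡ : suc n ℕ.+ suc (b ℕ.+ b) ≡ n ℕ.+ 2 ℕ.* suc b
  steps≡ = trans (sym (ℕ.+-suc n _)) (cong (λ x → n ℕ.+ suc x)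
    (trans (sym (ℕ.+-suc b b)) (cong (λ x → b ℕ.+ suc x) (sym (ℕ.+-identityʳ b)))))

mainTheorem8 : ∀ (k : ℕ) → 1 ≤ k →
    ∃ λ (p : Polyℤ) →
    HasLeadingTerm-x^ (2 ℕ.* k ∸ 1) p ×
    (∀ (n : ℕ) → scaledCount k n ≡ eval p (+ n) / 1)
mainTheorem8 (suc b) _ =
  -- The variable is N = n + 1, so the offset is 2b + 1 and the root N = 0 is the line x = -1;
  -- dividing by N lowers the degree from 2k to 2k - 1.
  let q , q-polynomial , factored = polynomial-root (solution-polynomial (suc (b ℕ.+ b)) b (suc b)) root
      -- The shift returns from N to n.
      p , leading , eval-p        = polynomial-coefficients (polynomial-shift q-polynomial)
  in p , subst (λ d → HasLeadingTerm-x^ d p) degree≡ leading , λ n →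
     quotient-integral (+ K) (+ F (n ℕ.+ 2 ℕ.* suc b) (+ n) (+ 0)) (eval p (+ n)) n
       (trans (cong (+ K ℤ.*_) (F-solution b n))
              (trans (factored (suc n)) (cong (+ suc n ℤ.*_) (eval-p n))))
  where
  K : ℕ
  K = suc b ! ℕ.* suc (suc b) !
  root : + K ℤ.* solution (suc b) (suc (b ℕ.+ b)) (suc b) 1 ≡ + 0
  root = trans (cong (+ K ℤ.*_) (solution-left b 1)) (ℤ.*-zeroʳ (+ K))
  degree≡ : b ℕ.+ suc b ≡ 2 ℕ.* suc b ∸ 1
  degree≡ = cong (λ x → b ℕ.+ suc x) (sym (ℕ.+-identityʳ b))
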